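{- Let $\chi$ be an infinite cardinal and let $\kappa\ge2^{\chi^+}$ be a cardinal. Then $\mathbf K^\chi$ fails $\mathrm{AP}(\kappa)$.
   Context: The class $\mathbf K^\chi$. Let $\tau^\chi$ be the three-sorted vocabulary with sorts $K,P,Q$; a constant $\mathbf 1$ of sort $P$; unary functions $\cdot^c:P\to P$, $\cap:Q\to P$ and $\pi_\alpha:Q\to P$ for $\alpha<\chi$; binary functions $\wedge,\vee:P\times P\to P$; and a binary relation $\varepsilon\subset K\times P$. Let $\psi^\chi\in\mathcal L_{\chi^+,\omega}$ be the conjunction of: (1) $\varepsilon$ is extensional (elements of $P$ with the same $\varepsilon$-members are equal); (2) $(P,\vee,\wedge,\cdot^c,\mathbf 1)$ is a Boolean algebra; (3) $\varepsilon$ interacts with the Boolean operations as expected: $\mathbf 1$ contains every element of $K$, $x\,\varepsilon\,X^c$ iff not $x\,\varepsilon\,X$, $x\,\varepsilon\,X\wedge Y$ iff $x\,\varepsilon\,X$ and $x\,\varepsilon\,Y$, $x\,\varepsilon\,X\vee Y$ iff $x\,\varepsilon\,X$ or $x\,\varepsilon\,Y$; (4) $P$ contains all singletons: $\forall x\in K\,\exists Y\in P\,\forall z\in K\,(z\,\varepsilon\,Y\iff z=x)$; (5) $\forall A,B\in Q\,(A=B\iff\bigwedge_{\alpha<\chi}\pi_\alpha(A)=\pi_\alpha(B))$; (6) $\forall A\in Q\,\forall x\in K\,(x\,\varepsilon\,\cap A\iff\bigwedge_{\alpha<\chi}x\,\varepsilon\,\pi_\alpha(A))$. For $M\models\psi^\chi$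 and $X\in P^M$ put $\widehat X^M=\{x\in K^M: M\models x\,\varepsilon\,X\}$. $\mathbf K^\chi$ is the class of all models of $\psi^\chi$ of size $\ge\chi$, and $M\prec^\chi N$ means that $M$ is a substructure of $N$ and $\widehat X^M=\widehat X^N$ for every $X\in P^M$ with $\widehat X^M$ finite. A $\mathbf K^\chi$-embedding $f:M\to N$ is an isomorphism of $M$ onto some $M'\prec^\chi N$. $\mathbf K^\chi$ satisfies $\mathrm{AP}(\kappa)$ (amalgamation in $\kappa$) iff $\mathbf K^\chi$ has a member of size $\kappa$ and for all $M_0,M_1,M_2\in\mathbf K^\chi$ of size $\kappa$ with $M_0\prec^\chi M_1$ and $M_0\prec^\chi M_2$ there are $N\in\mathbf K^\chi$ (of any size) and $\mathbf K^\chi$-embeddings $f_\ell:M_\ell\to N$, $\ell=1,2$, which agree on $M_0$. -}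

module Defs where

open import Level using (Level; suc; _⊔_)
open import Data.Bool using (Bool)
open import Data.Fin using (Fin)
open import Data.Nat using (ℕ)
open import Data.Product using (Σ; Σ-syntax; ∃; ∃-syntax; _×_; _,_; proj₁; proj₂)
open import Data.Sum using (_⊎_)
open import Data.Sum.Relation.Binary.Pointwise using (_⊎ₛ_)
open import Function.Bundles using (Func; Injection; Surjection; Inverse; _⇔_; _⟨$⟩_)
open import Function.Relation.Binary.Setoid.Equality using (_⇨_)
open import Algebra.Core using (Op₁; Op₂)
open import Algebra.Definitions using (Congruent₁; Congruent₂)
open import Algebra.Lattice.Structures using (IsBooleanAlgebra)
open import Relation.Binary.Bundles using (Setoid)
open import Relation.Binary.PropositionalEquality using (setoid)
open import Relation.Nullary using (¬_)
open import Relation.Unary using (Pred; _∈_; _≐_)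
import Relation.Binary.Construct.On as On

open Setoid using (Carrier)

------------------------------------------------------------------------
-- Sets and cardinals
--
-- A set is a setoid, and a cardinal is represented by any setoid of that
-- cardinality; cardinals are compared by means of injections.

-- Every Surjection of the library already carries a section, but one that
-- need not respect _≈_.  The axiom of choice provides one that does.

AxiomOfChoice : (ℓ : Level) → Set (suc ℓ)
AxiomOfChoice ℓ = (A B : Setoid ℓ ℓ) (f : Surjection A B) →
  Σ[ s ∈ Func B A ] (∀ b → Setoid._≈_ B (Surjection.to f (s ⟨$⟩ b)) b)

subsetoid : ∀ {a r p} (S : Setoid a r) → Pred (Carrier S) p → Setoid (a ⊔ p) r
subsetoid S A = On.setoid {B = Σ (Carrier S) A} S proj₁

Finite : ∀ {a r} → Setoid a r → Set (a ⊔ r)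
Finite S = ∃[ n ] Inverse (setoid (Fin n)) S

Infinite : ∀ {a r} → Setoid a r → Set (a ⊔ r)
Infinite S = ¬ Finite S

infix 4 _≤ᶜ_ _<ᶜ_ _≈ᶜ_

_≤ᶜ_ : ∀ {a r b s} → Setoid a r → Setoid b s → Set (a ⊔ r ⊔ b ⊔ s)
A ≤ᶜ B = Injection A B

_<ᶜ_ : ∀ {a r b s} → Setoid a r → Setoid b s → Set (a ⊔ r ⊔ b ⊔ s)
A <ᶜ B = A ≤ᶜ B × ¬ (B ≤ᶜ A)

_≈ᶜ_ : ∀ {a r b s} → Setoid a r → Setoid b s → Set (a ⊔ r ⊔ b ⊔ s)
A ≈ᶜ B = Inverse A B

IsSuccessorOf : ∀ {ℓ} → Setoid ℓ ℓ → Setoid ℓ ℓ → Set (suc ℓ)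
IsSuccessorOf {ℓ} χ⁺ χ = χ <ᶜ χ⁺ × ((μ : Setoid ℓ ℓ) → χ <ᶜ μ → χ⁺ ≤ᶜ μ)

2^_ : ∀ {ℓ} → Setoid ℓ ℓ → Setoid ℓ ℓ
2^ μ = μ ⇨ setoid Bool

module _ {ℓ : Level} (χ : Setoid ℓ ℓ) where

  private module χ = Setoid χ

  ----------------------------------------------------------------------
  -- Structures for the vocabulary τ^χ

  record Structure : Set (suc ℓ) where
    infix  4 _ε_
    infixr 7 _∧_
    infixr 6 _∨_
    infix  8 _ᶜ
    field
      K P Q : Setoid ℓ ℓ

    module K = Setoid K
    module P = Setoid P
    module Q = Setoid Q

    field
      𝟏       : P.Carrier
      _ᶜ      : Op₁ P.Carrier
      ∩       : Q.Carrier → P.Carrier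
      π       : χ.Carrier → Q.Carrier → P.Carrier
      _∧_ _∨_ : Op₂ P.Carrier
      _ε_     : K.Carrier → P.Carrier → Set ℓ

      ᶜ-cong : Congruent₁ P._≈_ _ᶜ
      ∩-cong : ∀ {A B} → A Q.≈ B → ∩ A P.≈ ∩ B
      π-cong : ∀ {α β A B} → α χ.≈ β → A Q.≈ B → π α A P.≈ π β B
      ∧-cong : Congruent₂ P._≈_ _∧_
      ∨-cong : Congruent₂ P._≈_ _∨_
      ε-resp : ∀ {x y X Y} → x K.≈ y → X P.≈ Y → x ε X → y ε Y

    -- The set denoted X̂ in the literature.
    hat : P.Carrier → Pred K.Carrier ℓ
    hat X x = x ε X

    universe : Setoid ℓ ℓ
    universe = K ⊎ₛ (P ⊎ₛ Q)

  ----------------------------------------------------------------------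
  -- The sentence ψ^χ

  record _⊨ψ (M : Structure) : Set ℓ where
    open Structure M
    field
      extensional : ∀ X Y → (∀ x → (x ε X) ⇔ (x ε Y)) → X P.≈ Y

      -- The vocabulary has no constant for the least element; it is 𝟏 ᶜ.
      isBooleanAlgebra : IsBooleanAlgebra P._≈_ _∨_ _∧_ _ᶜ 𝟏 (𝟏 ᶜ)

      ε-𝟏 : ∀ x → x ε 𝟏
      ε-ᶜ : ∀ x X → (x ε X ᶜ) ⇔ (¬ (x ε X))
      ε-∧ : ∀ x X Y → (x ε X ∧ Y) ⇔ ((x ε X) × (x ε Y))
      ε-∨ : ∀ x X Y → (x ε X ∨ Y) ⇔ ((x ε X) ⊎ (x ε Y))

      singletons : ∀ x → ∃[ Y ] (∀ z → (z ε Y) ⇔ (z K.≈ x))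

      π-extensional : ∀ A B → (A Q.≈ B) ⇔ (∀ α → π α A P.≈ π α B)

      ε-∩ : ∀ A x → (x ε ∩ A) ⇔ (∀ α → x ε π α A)

  ----------------------------------------------------------------------
  -- Substructures, isomorphisms, and the relation ≺^χ

  record Substructure (N : Structure) : Set (suc ℓ) where
    open Structure N
    field
      inK : Pred K.Carrier ℓ
      inP : Pred P.Carrier ℓ
      inQ : Pred Q.Carrier ℓ

      inK-resp : ∀ {x y} → x K.≈ y → x ∈ inK → y ∈ inK
      inP-resp : ∀ {X Y} → X P.≈ Y → X ∈ inP → Y ∈ inP
      inQ-resp : ∀ {A B} → A Q.≈ B → A ∈ inQ → B ∈ inQ

      𝟏-closed : 𝟏 ∈ inP
      ᶜ-closed : ∀ {X} → X ∈ inP → X ᶜ ∈ inP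
      ∩-closed : ∀ {A} → A ∈ inQ → ∩ A ∈ inP
      π-closed : ∀ α {A} → A ∈ inQ → π α A ∈ inP
      ∧-closed : ∀ {X Y} → X ∈ inP → Y ∈ inP → X ∧ Y ∈ inP
      ∨-closed : ∀ {X Y} → X ∈ inP → Y ∈ inP → X ∨ Y ∈ inP

    structure : Structure
    structure = record
      { K      = subsetoid K inK
      ; P      = subsetoid P inP
      ; Q      = subsetoid Q inQ
      ; 𝟏      = 𝟏 , 𝟏-closed
      ; _ᶜ     = λ (X , p) → X ᶜ , ᶜ-closed p
      ; ∩      = λ (A , q) → ∩ A , ∩-closed q
      ; π      = λ α (A , q) → π α A , π-closed α q
      ; _∧_    = λ (X , p) (Y , q) → X ∧ Y , ∧-closed p q
      ; _∨_    = λ (X , p) (Y , q) → X ∨ Y , ∨-closed p q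
      ; _ε_    = λ (x , _) (X , _) → x ε X
      ; ᶜ-cong = ᶜ-cong
      ; ∩-cong = ∩-cong
      ; π-cong = π-cong
      ; ∧-cong = ∧-cong
      ; ∨-cong = ∨-cong
      ; ε-resp = ε-resp
      }

  -- For a substructure M of N, `Strong M` says M ≺^χ N.  The set X̂^M, a
  -- subset of K^M, is regarded as a subset of K^N.

  Strong : {N : Structure} → Substructure N → Set ℓ
  Strong {N} M = (X : M.P.Carrier) →
    Finite (subsetoid M.K (M.hat X)) →
    (λ y → Σ[ k ∈ y ∈ inK ] ((y , k) ∈ M.hat X)) ≐ N.hat (proj₁ X)
    where
    open Substructure M using (inK; structure)
    module M = Structure structure
    module N = Structure N

  record Isomorphism (M N : Structure) : Set ℓ where
    private
      module M = Structure M
      module N = Structure N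
    field
      isoK : Inverse M.K N.K
      isoP : Inverse M.P N.P
      isoQ : Inverse M.Q N.Q

    onK : M.K.Carrier → N.K.Carrier
    onK = Inverse.to isoK

    onP : M.P.Carrier → N.P.Carrier
    onP = Inverse.to isoP

    onQ : M.Q.Carrier → N.Q.Carrier
    onQ = Inverse.to isoQ

    field
      𝟏-homo : onP M.𝟏 N.P.≈ N.𝟏
      ᶜ-homo : ∀ X → onP (X M.ᶜ) N.P.≈ (onP X) N.ᶜ
      ∩-homo : ∀ A → onP (M.∩ A) N.P.≈ N.∩ (onQ A)
      π-homo : ∀ α A → onP (M.π α A) N.P.≈ N.π α (onQ A)
      ∧-homo : ∀ X Y → onP (X M.∧ Y) N.P.≈ (onP X N.∧ onP Y)
      ∨-homo : ∀ X Y → onP (X M.∨ Y) N.P.≈ (onP X N.∨ onP Y)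
      ε-homo : ∀ x X → (x M.ε X) ⇔ (onK x N.ε onP X)

  record Embedding (M N : Structure) : Set (suc ℓ) where
    field
      image  : Substructure N
      strong : Strong image
      iso    : Isomorphism M (Substructure.structure image)

    private
      module M = Structure M
      module N = Structure N

    embK : M.K.Carrier → N.K.Carrier
    embK x = proj₁ (Isomorphism.onK iso x)

    embP : M.P.Carrier → N.P.Carrier
    embP X = proj₁ (Isomorphism.onP iso X)

    embQ : M.Q.Carrier → N.Q.Carrier
    embQ A = proj₁ (Isomorphism.onQ iso A)

  ----------------------------------------------------------------------
  -- The class 𝐊^χ and amalgamation

  record 𝐊 : Set (suc ℓ) where
    field
      structure : Structure
      models    : structure ⊨ψ
      large     : χ ≤ᶜ Structure.universe structure

    open Structure structure public

  HasSize : 𝐊 → Setoid ℓ ℓ → Set ℓ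
  HasSize M κ = 𝐊.universe M ≈ᶜ κ

  infix 4 _↪_
  _↪_ : 𝐊 → 𝐊 → Set (suc ℓ)
  M ↪ N = Embedding (𝐊.structure M) (𝐊.structure N)

  -- Elements have no identity across types, so M₀ ≺^χ M is rendered by an
  -- embedding i : M₀ ↪ M playing the role of the inclusion, and two maps
  -- out of M₁ and M₂ agree on M₀ when they agree after these inclusions.

  record Amalgam (M₀ M₁ M₂ : 𝐊) (i₁ : M₀ ↪ M₁) (i₂ : M₀ ↪ M₂) : Set (suc ℓ) where
    private
      module M₀ = 𝐊 M₀
      module i₁ = Embedding i₁
      module i₂ = Embedding i₂
    field
      N  : 𝐊
      f₁ : M₁ ↪ N
      f₂ : M₂ ↪ N

    private
      module N  = 𝐊 N
      module f₁ = Embedding f₁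
      module f₂ = Embedding f₂

    field
      agreeK : (x : M₀.K.Carrier) → f₁.embK (i₁.embK x) N.K.≈ f₂.embK (i₂.embK x)
      agreeP : (X : M₀.P.Carrier) → f₁.embP (i₁.embP X) N.P.≈ f₂.embP (i₂.embP X)
      agreeQ : (A : M₀.Q.Carrier) → f₁.embQ (i₁.embQ A) N.Q.≈ f₂.embQ (i₂.embQ A)

  AP : Setoid ℓ ℓ → Set (suc ℓ)
  AP κ = (∃[ M ] HasSize M κ) ×
    ((M₀ M₁ M₂ : 𝐊) → HasSize M₀ κ → HasSize M₁ κ → HasSize M₂ κ →
     (i₁ : M₀ ↪ M₁) (i₂ : M₀ ↪ M₂) → Amalgam M₀ M₁ M₂ i₁ i₂)

{-# OPTIONS --safe #-}

-- Let Γ = 2^χ and K₀ = Γ ⊎ κ.  In M₀ the sort P is the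
-- algebra generated by the set Γ and the singletons, and Q is empty.  M₁ adds
-- to K₀ a point ∞ of Γ; this is a strong extension because only infinite sets
-- of M₀ grow.  M₂ keeps K₀ and adds the coordinate sets {f ∈ Γ : f α = 1}
-- together with, for each g ∈ Γ, the sequence of the sets
-- {f ∈ Γ : f α = g α}, whose intersection is {g}.  In an amalgam, the
-- coordinate sets containing ∞ determine some g ∈ Γ, and then ∞ lies in the
-- intersection {g}; but {g} belongs to M₀, and ∞ ∉ {g} already in M₁.
--
-- That the three models have size κ rests on κ · κ = κ, which is proved by
-- Zorn's lemma.

module Submission where

open import Defs
open import Level using (Level; Lift; lift; lower)
open import Algebra.Lattice.Structures using (IsBooleanAlgebra)
open import Axiom.ExcludedMiddle using (ExcludedMiddle)
open import Axiom.UniquenessOfIdentityProofs.WithK using (uip)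
open import Data.Bool using (Bool; true; false; T; _∧_; _∨_; not)
open import Data.Bool.Properties
  using (T-∨; T-∧; T-≡; T-not-≡; T-irrelevant; ∨-∧-isBooleanAlgebra)
open import Data.Empty using (⊥-elim)
open import Data.Empty.Polymorphic using (⊥)
open import Data.Fin using (Fin; zero; suc; toℕ)
open import Data.Fin.Properties using (injective⇒≤; toℕ-injective)
open import Data.Maybe using (Maybe; just; nothing; maybe)
open import Data.Nat as ℕ using (ℕ; zero; suc; _+_; _*_; _≤_; _<_)
open import Data.Nat.Properties
  using (1+n≰n; even≢odd; suc-injective; *-cancelˡ-≡; +-cancelˡ-≡; <-cmp; <-irrefl;
         m<1+n⇒m<n∨m≡n; m≤m+n; m≤m⊔n; m≤n⊔m; ≤-trans)
open import Data.Product using (Σ; Σ-syntax; ∃-syntax; _×_; _,_; proj₁; proj₂)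
open import Data.Product.Function.NonDependent.Propositional using (_×-↣_)
open import Data.Product.Properties using (,-injective)
open import Data.Sum using (_⊎_; inj₁; inj₂; [_,_]′)
open import Data.Sum.Function.Propositional using (_⊎-↣_)
open import Data.Sum.Function.Setoid using (_⊎-injection_)
open import Data.Sum.Properties using (inj₁-injective; inj₂-injective)
open import Data.Sum.Relation.Binary.Pointwise using (_⊎ₛ_; Pointwise-≡↔≡; inj₁)
open import Data.Unit.Polymorphic using (⊤; tt)
open import Function.Base using (_∘_; id; case_of_; const)
open import Function.Bundles
  using (Func; Injection; Inverse; Equivalence; _⇔_; mk⇔; _⟨$⟩_; _↣_; _↔_; mk↣; mk⤖)
import Function.Construct.Composition as Compose
import Function.Construct.Symmetry as Symmetry
open import Function.Properties.Bijection using (⤖⇒↔)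
open import Function.Properties.Inverse using (Inverse⇒Injection)
open import Relation.Binary.Bundles using (Setoid)
open import Relation.Binary.Definitions using (tri<; tri≈; tri>)
open import Relation.Binary.PropositionalEquality
  using (_≡_; _≢_; refl; sym; trans; cong; cong₂; subst; setoid)
open import Relation.Nullary using (¬_; Dec; yes; no; contradiction)
open import Relation.Nullary.Decidable using (⌊_⌋; toWitness; fromWitness; decidable-stable)

open Setoid using (Carrier)
open Injection using (to; injective)
open Equivalence using () renaming (to to ⇒; from to ⇐)

-- Zorn's lemma

_∪_ : ∀ {a} {X : Set a} → (X → Bool) → (X → Bool) → X → Bool
(R ∪ S) x = R x ∨ S x

infix 4 _⊆_
_⊆_ : ∀ {a} {X : Set a} → (X → Bool) → (X → Bool) → Set a
R ⊆ S = ∀ {x} → T (R x) → T (S x)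

T-ext : ∀ {b c} → (T b → T c) → (T c → T b) → b ≡ c
T-ext {true}  {true}  _ _ = refl
T-ext {true}  {false} f _ = ⊥-elim (f _)
T-ext {false} {true}  _ g = ⊥-elim (g _)
T-ext {false} {false} _ _ = refl

-- Replaces closure under unions of chains: a property that inspects at most two elements of a
-- subset at a time passes from the sets `R` to `U`.
Directed : ∀ {a} {X : Set a} → ((X → Bool) → Set a) → (X → Bool) → Set a
Directed 𝓕 U = ∀ {u v} → T (U u) → T (U v) → ∃[ R ] 𝓕 R × R ⊆ U × T (R u) × T (R v)

module Classical {ℓ : Level} (em : ExcludedMiddle ℓ) where

  ⟦_⟧ : Set ℓ → Bool
  ⟦ A ⟧ = ⌊ em {A} ⌋

  ⟦_⟧⁺ : ∀ {A : Set ℓ} → A → T ⟦ A ⟧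
  ⟦_⟧⁺ = fromWitness

  ⟦_⟧⁻ : ∀ {A : Set ℓ} → T ⟦ A ⟧ → A
  ⟦_⟧⁻ = toWitness

  by-contradiction : {A : Set ℓ} → ¬ ¬ A → A
  by-contradiction = decidable-stable em

module Choice {ℓ : Level} (em : ExcludedMiddle ℓ) (ac : AxiomOfChoice ℓ) where

  open Classical em

  -- Choice is applied to the identity map from propositional equality to `_≈_`: a section
  -- respecting `_≈_` picks one representative of each class.
  canonical : (S : Setoid ℓ ℓ) →
    Σ[ s ∈ Func S (setoid (Carrier S)) ] (∀ b → Setoid._≈_ S (s ⟨$⟩ b) b)
  canonical S = ac (setoid (Carrier S)) S (record
    { to         = id
    ; cong       = λ { refl → S.refl }
    ; surjective = λ y → y , λ { refl → S.refl }
    })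
    where module S = Setoid S

  -- The tower generated by R ↦ s R and unions is a chain, so its union is a
  -- fixed point of s (Bourbaki–Witt).
  module Zorn {X : Set ℓ} (𝓕 : (X → Bool) → Set ℓ)
    (closed : ∀ U → Directed 𝓕 U → 𝓕 U)
    where

    Subset : Set ℓ
    Subset = X → Bool

    private
      Proper : Subset → Set ℓ
      Proper R = ∃[ R′ ] 𝓕 R′ × R ⊆ R′ × ¬ R′ ⊆ R

      -- The witness carried by `em` serves as a choice function; a subset without proper extension
      -- in `𝓕` stays fixed.
      extend : Subset → Subset
      extend R with em {Proper R}
      ... | yes (R′ , _) = R′
      ... | no _         = R

      extend-⊆ : ∀ R → R ⊆ extend R
      extend-⊆ R with em {Proper R}
      ... | yes (_ , _ , R⊆R′ , _) = R⊆R′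
      ... | no _                   = id

      extend-𝓕 : ∀ R → 𝓕 R → 𝓕 (extend R)
      extend-𝓕 R r with em {Proper R}
      ... | yes (_ , r′ , _) = r′
      ... | no _             = r

      extend-maximal : ∀ R → extend R ⊆ R → ¬ Proper R
      extend-maximal R sR⊆R p with em {Proper R}
      ... | yes (_ , _ , _ , R′⊈R) = R′⊈R sR⊆R
      ... | no ¬p                  = ¬p p

      subsets : Setoid ℓ ℓ
      subsets = record
        { Carrier       = Subset
        ; _≈_           = λ R S → ∀ x → R x ≡ S x
        ; isEquivalence = record
          { refl  = λ _ → refl
          ; sym   = λ p x → sym (p x)
          ; trans = λ p q x → trans (p x) (q x)
          }
        }

      nf : Subset → Subset
      nf R = proj₁ (canonical subsets) ⟨$⟩ R

      nf-≡ : ∀ R x → nf R x ≡ R x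
      nf-≡ = proj₂ (canonical subsets)

      ⊆-nf : ∀ R → R ⊆ nf R
      ⊆-nf R {x} = subst T (sym (nf-≡ R x))

      nf-⊆ : ∀ R → nf R ⊆ R
      nf-⊆ R {x} = subst T (nf-≡ R x)

      -- Without the normal form, s would not respect equality of subsets.
      s : Subset → Subset
      s R = extend (nf R)

      ⊆-s : ∀ R → R ⊆ s R
      ⊆-s R = extend-⊆ (nf R) ∘ ⊆-nf R

      s-cong : ∀ {R S} → R ⊆ S → S ⊆ R → s R ⊆ s S
      s-cong R⊆S S⊆R {x} = subst (λ U → T (extend U x))
        (Func.cong (proj₁ (canonical subsets)) (λ x → T-ext R⊆S S⊆R))

      ⋃ : (Subset → Bool) → Subset
      ⋃ C x = ⟦ (∃[ R ] T (C R) × T (R x)) ⟧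

      ⋃-upper : ∀ {C R} → T (C R) → R ⊆ ⋃ C
      ⋃-upper c r = ⟦ _ , c , r ⟧⁺

      ⋃-least : ∀ {C U} → (∀ {R} → T (C R) → R ⊆ U) → ⋃ C ⊆ U
      ⋃-least b u = let (_ , c , r) = ⟦ u ⟧⁻ in b c r

      data Tower : Subset → Set ℓ where
        step : ∀ {R} → Tower R → Tower (s R)
        sup  : ∀ C → (∀ {R} → T (C R) → Tower R) → Tower (⋃ C)

      -- The extreme points of the Bourbaki-Witt argument: no step that starts properly below `E`
      -- leaves `E`.
      Extreme : Subset → Set ℓ
      Extreme E = ∀ {R} → Tower R → R ⊆ E → ¬ E ⊆ R → s R ⊆ E

      -- Induction on the tower. As soon as one member of a union is not included in `E`, it
      -- contains `s E`, and so does the union.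
      extreme-compare : ∀ {E R} → Extreme E → Tower R → R ⊆ E ⊎ s E ⊆ R
      extreme-compare {E} ex (step {R} r) with extreme-compare ex r
      ... | inj₂ sE⊆R = inj₂ (⊆-s R ∘ sE⊆R)
      ... | inj₁ R⊆E with em {E ⊆ R}
      ...   | yes E⊆R = inj₂ (s-cong E⊆R R⊆E)
      ...   | no  E⊈R = inj₁ (ex r R⊆E E⊈R)
      extreme-compare {E} ex (sup C c) with em {∃[ R ] T (C R) × ¬ R ⊆ E}
      ... | no ¬p = inj₁ (⋃-least λ {R} cR → by-contradiction λ R⊈E → ¬p (R , cR , R⊈E))
      ... | yes (R , cR , R⊈E) with extreme-compare ex (c cR)
      ...   | inj₁ R⊆E  = contradiction (λ {x} → R⊆E {x}) R⊈E
      ...   | inj₂ sE⊆R = inj₂ (⋃-upper cR ∘ sE⊆R)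

      -- Induction on `E`. A set `R` below `s E` is compared with `E`; a set `R` properly below a
      -- union is compared with some member of the union not included in `R`.
      extreme : ∀ {E} → Tower E → Extreme E
      extreme (step {E} e) {R} r R⊆sE sE⊈R with extreme-compare (extreme e) r
      ... | inj₂ sE⊆R = contradiction (λ {x} → sE⊆R {x}) sE⊈R
      ... | inj₁ R⊆E with em {E ⊆ R}
      ...   | yes E⊆R = s-cong R⊆E E⊆R
      ...   | no  E⊈R = ⊆-s E ∘ extreme e r R⊆E E⊈R
      extreme (sup C c) {R} r R⊆U U⊈R with em {∃[ S ] T (C S) × ¬ S ⊆ R}
      ... | no ¬p = contradiction
                      (λ {x} → ⋃-least {C} {R} (λ {S} cS → by-contradiction λ S⊈R → ¬p (S , cS , S⊈R)) {x})
                      U⊈R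
      ... | yes (S , cS , S⊈R) with extreme-compare (extreme (c cS)) r
      ...   | inj₁ R⊆S  = ⋃-upper cS ∘ extreme (c cS) r R⊆S S⊈R
      ...   | inj₂ sS⊆R = contradiction (λ {x} → sS⊆R {x} ∘ ⊆-s S) S⊈R

      Tower-total : ∀ {R S} → Tower R → Tower S → R ⊆ S ⊎ S ⊆ R
      Tower-total {R} {S} r q with extreme-compare (extreme r) q
      ... | inj₁ S⊆R  = inj₂ S⊆R
      ... | inj₂ sR⊆S = inj₁ (sR⊆S ∘ ⊆-s R)

      Tower-𝓕 : ∀ {R} → Tower R → 𝓕 R
      -- `𝓕` is not assumed to respect pointwise equality; `nf R` belongs to it by `closed`, with
      -- `R` as the common member.
      Tower-𝓕 (step {R} r) = extend-𝓕 (nf R) (closed (nf R) λ u v →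
        R , Tower-𝓕 r , ⊆-nf R , nf-⊆ R u , nf-⊆ R v)
      Tower-𝓕 (sup C c) = closed (⋃ C) common
        where
        common : Directed 𝓕 (⋃ C)
        common u∈ v∈ with ⟦ u∈ ⟧⁻ | ⟦ v∈ ⟧⁻
        ... | R , cR , uR | S , cS , vS with Tower-total (c cR) (c cS)
        ...   | inj₁ R⊆S = S , Tower-𝓕 (c cS) , ⋃-upper cS , R⊆S uR , vS
        ...   | inj₂ S⊆R = R , Tower-𝓕 (c cR) , ⋃-upper cR , uR , S⊆R vS

      top : Subset
      top = ⋃ (λ R → ⟦ Tower R ⟧)

      top-Tower : Tower top
      top-Tower = sup _ ⟦_⟧⁻

    maximal : ∃[ R ] 𝓕 R × (∀ {S} → 𝓕 S → R ⊆ S → S ⊆ R)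
    maximal = nf top , nf-𝓕 , λ {S} f R⊆S → by-contradiction λ S⊈R →
        extend-maximal (nf top)
          -- `s top` is itself in the tower, hence included in the union `top`, so `extend` adds
          -- nothing to `nf top`.
          (⊆-nf top ∘ ⋃-upper {R = s top} ⟦ step top-Tower ⟧⁺)
          (S , f , R⊆S , S⊈R)
      where
      nf-𝓕 : 𝓕 (nf top)
      nf-𝓕 = closed (nf top) λ u v →
        top , Tower-𝓕 top-Tower , ⊆-nf top , nf-⊆ top u , nf-⊆ top v

  -- Zorn's lemma is applied to the sets `R` for which `R₀ ∪ R` is in `𝓕`.
  zorn-above : {X : Set ℓ} (𝓕 : (X → Bool) → Set ℓ) →
    (∀ U → Directed 𝓕 U → 𝓕 U) →
    ∀ {R₀} → 𝓕 R₀ →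
    ∃[ R ] 𝓕 R × R₀ ⊆ R × (∀ {S} → 𝓕 S → R ⊆ S → S ⊆ R)
  zorn-above 𝓕 closed {R₀} f₀ =
    let (R , f , max) = Zorn.maximal (λ R → 𝓕 (R₀ ∪ R)) closed′
    in R₀ ∪ R , f , left {R₀} {R} , λ {S} g R₀∪R⊆S →
         -- Since `R₀ ⊆ S`, the sets `R₀ ∪ S` and `S` have the same elements, and `closed` with
         -- common member `S` puts the former in `𝓕`.
         right {R₀} {R} ∘ max {S} (closed (R₀ ∪ S) λ u v →
             S , g , right {R₀} {S} , join R₀∪R⊆S u , join R₀∪R⊆S v)
           (R₀∪R⊆S ∘ right {R₀} {R})
    where
    left : ∀ {R S} → R ⊆ R ∪ S
    left r = ⇐ T-∨ (inj₁ r)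

    right : ∀ {R S} → S ⊆ R ∪ S
    right {R} {x = x} s = ⇐ (T-∨ {R x}) (inj₂ s)

    join : ∀ {R S} → R₀ ∪ R ⊆ S → R₀ ∪ S ⊆ S
    join {R} R₀∪R⊆S {x} = [ R₀∪R⊆S ∘ left {R₀} {R} , id ]′ ∘ ⇒ (T-∨ {R₀ x})

    closed′ : ∀ U → Directed (λ R → 𝓕 (R₀ ∪ R)) U → 𝓕 (R₀ ∪ U)
    closed′ U h = closed (R₀ ∪ U) common
      where
      widen : ∀ {R} → R ⊆ U → R₀ ∪ R ⊆ R₀ ∪ U
      widen {R} R⊆U {x} = [ left {R₀} {U} , right {R₀} {U} ∘ R⊆U ]′ ∘ ⇒ (T-∨ {R₀ x})

      common : Directed 𝓕 (R₀ ∪ U)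
      common {u} {v} u∈ v∈ with ⇒ (T-∨ {R₀ u}) u∈ | ⇒ (T-∨ {R₀ v}) v∈
      ... | inj₁ u₀ | inj₁ v₀ = R₀ , f₀ , left {R₀} {U} , u₀ , v₀
      ... | inj₁ u₀ | inj₂ vU with h vU vU
      ...   | R , f , R⊆U , vR , _ = R₀ ∪ R , f , widen R⊆U , left {R₀} {R} u₀ , right {R₀} {R} vR
      common u∈ v∈ | inj₂ uU | inj₁ v₀ with h uU uU
      ...   | R , f , R⊆U , uR , _ = R₀ ∪ R , f , widen R⊆U , right {R₀} {R} uR , left {R₀} {R} v₀
      common u∈ v∈ | inj₂ uU | inj₂ vU with h uU vU
      ...   | R , f , R⊆U , uR , vR = R₀ ∪ R , f , widen R⊆U , right {R₀} {R} uR , right {R₀} {R} vR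

-- Cardinal arithmetic

≤ᶜ-trans : ∀ {a r b s c t} {A : Setoid a r} {B : Setoid b s} {C : Setoid c t} →
           A ≤ᶜ B → B ≤ᶜ C → A ≤ᶜ C
≤ᶜ-trans = Compose.injection

-- The injection sending `(m , n)` to 2^m (2n + 1).
pairℕ : ℕ → ℕ → ℕ
pairℕ zero    n = suc (2 * n)
pairℕ (suc m) n = 2 * pairℕ m n

pairℕ-injective : ∀ m n {m′ n′} → pairℕ m n ≡ pairℕ m′ n′ → m ≡ m′ × n ≡ n′
pairℕ-injective zero    n {zero} {n′} eq = refl , *-cancelˡ-≡ n n′ 2 (suc-injective eq)
pairℕ-injective zero    n {suc m′} {n′} eq = contradiction (sym eq) (even≢odd (pairℕ m′ n′) n)
pairℕ-injective (suc m) n {zero} {n′} eq = contradiction eq (even≢odd (pairℕ m n) n′)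
pairℕ-injective (suc m) n {suc m′} eq =
  let (m≡ , n≡) = pairℕ-injective m n (*-cancelˡ-≡ (pairℕ m n) _ 2 eq)
  in cong suc m≡ , n≡

Σ-T-≡ : ∀ {a} {A : Set a} {b : A → Bool} {x y : Σ A (T ∘ b)} → proj₁ x ≡ proj₁ y → x ≡ y
Σ-T-≡ {b = b} {x , p} {.x , q} refl = cong (x ,_) (T-irrelevant {b x} p q)

-- The two distinct elements tag the summands, and a tagged element is a pair.
doubling : ∀ {a} {A : Set a} {a₀ a₁ : A} → a₀ ≢ a₁ → (A × A) ↣ A → (A ⊎ A) ↣ A
doubling {a₀ = a₀} {a₁} a₀≢a₁ f = mk↣ {to = code} code-injective
  where
  code : _ → _
  code (inj₁ x) = to f (a₀ , x)
  code (inj₂ x) = to f (a₁ , x)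

  code-injective : ∀ {x y} → code x ≡ code y → x ≡ y
  code-injective {inj₁ x} {inj₁ y} eq = cong inj₁ (proj₂ (,-injective (injective f eq)))
  code-injective {inj₁ x} {inj₂ y} eq = contradiction (proj₁ (,-injective (injective f eq))) a₀≢a₁
  code-injective {inj₂ x} {inj₁ y} eq = contradiction (sym (proj₁ (,-injective (injective f eq)))) a₀≢a₁
  code-injective {inj₂ x} {inj₂ y} eq = cong inj₂ (proj₂ (,-injective (injective f eq)))

-- Infinite sets and the Cantor-Bernstein theorem

ℕ≤⇒Infinite : ∀ {a r} {S : Setoid a r} → setoid ℕ ≤ᶜ S → Infinite S
ℕ≤⇒Infinite e (n , i) = 1+n≰n (injective⇒≤ {f = f} f-injective)
  where

  f : Fin (suc n) → Fin n
  f = Inverse.from i ∘ to e ∘ toℕ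

  f-injective : ∀ {x y} → f x ≡ f y → x ≡ y
  f-injective = toℕ-injective ∘ injective e ∘ injective (Inverse⇒Injection (Symmetry.inverse i))

-- The points of `A` reached from outside the range of `g` by iterating `g` after `f`.
data Chain {ℓ} {A B : Set ℓ} (f : A → B) (g : B → A) : A → Set ℓ where
  stray : ∀ {a} → ¬ (∃[ b ] g b ≡ a) → Chain f g a
  along : ∀ {a} → Chain f g a → Chain f g (g (f a))

module _ {ℓ : Level} (em : ExcludedMiddle ℓ) where

  open Classical em

  Infinite⇒ℕ≤ : (S : Setoid ℓ ℓ) → Infinite S → setoid ℕ ≤ᶜ S
  Infinite⇒ℕ≤ S inf = record
    { to        = a
    ; cong      = λ { refl → S.refl }
    ; injective = λ {m} {n} → a-injective m n
    }
    where
    module S = Setoid S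

    enum : ∀ n → Injection (setoid (Fin n)) S
    next : ∀ n → ∃[ c ] (∀ i → ¬ to (enum n) i S.≈ c)

    next n with em {∃[ c ] (∀ i → ¬ to (enum n) i S.≈ c)}
    ... | yes p = p
    -- Without a fresh element the list `enum n` would be a bijection from `Fin n`.
    ... | no ¬p = contradiction (n , record
      { to        = to (enum n)
      ; from      = proj₁ ∘ index
      ; to-cong   = Injection.cong (enum n)
      ; from-cong = λ {x} {y} x≈y → injective (enum n)
          (S.trans (proj₂ (index x)) (S.trans x≈y (S.sym (proj₂ (index y)))))
      ; inverse   = (λ { {x} refl → proj₂ (index x) })
                  , λ {x} {y} y≈ → injective (enum n) (S.trans (proj₂ (index y)) y≈)
      }) inf
      where
      index : ∀ c → ∃[ i ] to (enum n) i S.≈ c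
      index c with em {Lift ℓ (∃[ i ] to (enum n) i S.≈ c)}
      ... | yes (lift p) = p
      ... | no ¬q = contradiction (c , λ i eq → ¬q (lift (i , eq))) ¬p

    enum zero    = record { to = λ () ; cong = λ { {()} } ; injective = λ { {()} } }
    enum (suc n) = record
      { to        = f
      ; cong      = λ { refl → S.refl }
      ; injective = f-injective
      }
      where
      f : Fin (suc n) → Carrier S
      f zero    = proj₁ (next n)
      f (suc i) = to (enum n) i

      f-injective : ∀ {i j} → f i S.≈ f j → i ≡ j
      f-injective {zero}  {zero}  _  = refl
      f-injective {zero}  {suc j} eq = contradiction (S.sym eq) (proj₂ (next n) j)
      f-injective {suc i} {zero}  eq = contradiction eq (proj₂ (next n) i)
      f-injective {suc i} {suc j} eq = cong suc (injective (enum n) eq)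

    a : ℕ → Carrier S
    a n = proj₁ (next n)

    listed : ∀ {m n} → m < n → ∃[ i ] to (enum n) i ≡ a m
    listed {n = suc n} m<1+n with m<1+n⇒m<n∨m≡n m<1+n
    ... | inj₂ refl = zero , refl
    ... | inj₁ m<n  = let (i , eq) = listed m<n in suc i , eq

    a-fresh : ∀ {m n} → m < n → ¬ a m S.≈ a n
    a-fresh {n = n} m<n eq =
      let (i , p) = listed m<n in proj₂ (next n) i (S.trans (S.reflexive p) eq)

    a-injective : ∀ m n → a m S.≈ a n → m ≡ n
    a-injective m n eq with <-cmp m n
    ... | tri< m<n _ _ = contradiction eq (a-fresh m<n)
    ... | tri≈ _ m≡n _ = m≡n
    ... | tri> _ _ n<m = contradiction (S.sym eq) (a-fresh n<m)

  -- The bijection follows `f` on `Chain` and the inverse of `g` elsewhere.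
  cantor-bernstein : {A B : Set ℓ} → A ↣ B → B ↣ A → A ↔ B
  cantor-bernstein {A} {B} f g = ⤖⇒↔ (mk⤖ {to = h}
    ((λ {x} {y} → h-injective x y em em) , λ b →
      let (a , eq) = h-surjective b in a , λ { refl → eq }))
    where
    N : A → Set ℓ
    N = Chain (to f) (to g)

    preimage : ∀ {a} → ¬ N a → ∃[ b ] to g b ≡ a
    preimage ¬n = by-contradiction (¬n ∘ stray)

    h : A → B
    h a with em {N a}
    ... | yes _ = to f a
    ... | no ¬n = proj₁ (preimage ¬n)

    h-N : ∀ {a} → N a → h a ≡ to f a
    h-N {a} n with em {N a}
    ... | yes _ = refl
    ... | no ¬n = contradiction n ¬n

    h-¬N : ∀ {a} → ¬ N a → to g (h a) ≡ a
    h-¬N {a} ¬n with em {N a}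
    ... | yes n  = contradiction n ¬n
    ... | no ¬n′ = proj₂ (preimage ¬n′)

    h-separates : ∀ {x y} → N x → ¬ N y → h x ≢ h y
    -- A common value would give `y` = `g (f x)`, which is on a chain because `x` is.
    h-separates n ¬n eq =
      ¬n (subst N (trans (cong (to g) (trans (sym (h-N n)) eq)) (h-¬N ¬n)) (along n))

    h-injective : ∀ x y → Dec (N x) → Dec (N y) → h x ≡ h y → x ≡ y
    h-injective x y (yes n) (yes n′) eq = injective f (trans (sym (h-N n)) (trans eq (h-N n′)))
    h-injective x y (yes n) (no ¬n)  eq = contradiction eq (h-separates n ¬n)
    h-injective x y (no ¬n) (yes n)  eq = contradiction (sym eq) (h-separates n ¬n)
    h-injective x y (no ¬n) (no ¬n′) eq = trans (sym (h-¬N ¬n)) (trans (cong (to g) eq) (h-¬N ¬n′))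

    -- A point in the range of `g` cannot start a chain, so it has a predecessor on it.
    unstep : ∀ {x b} → N x → x ≡ to g b → ∃[ a ] N a × to f a ≡ b
    unstep (stray s) eq = contradiction (_ , sym eq) s
    unstep (along n) eq = _ , n , injective g eq

    h-surjective : ∀ b → ∃[ a ] h a ≡ b
    h-surjective b = case em {N (to g b)} of λ where
      (yes n) → let (a , n′ , eq) = unstep n refl in a , trans (h-N n′) eq
      (no ¬n) → to g b , injective g (h-¬N ¬n)

-- Comparability of cardinals and squares of infinite sets

module _ {ℓ : Level} (em : ExcludedMiddle ℓ) (ac : AxiomOfChoice ℓ) where

  open Classical em
  open Choice em ac

  -- A maximal partial injection is total on `A` or onto `B`: a pair of unmatched elements could be
  -- added to it.
  comparability : (A B : Set ℓ) → (A ↣ B) ⊎ (B ↣ A)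
  comparability A B with zorn-above Matching Matching-closed {λ _ → false} (λ ())
    where
    Matching : (A × B → Bool) → Set ℓ
    Matching R = ∀ {a b a′ b′} → T (R (a , b)) → T (R (a′ , b′)) →
                 (a ≡ a′ → b ≡ b′) × (b ≡ b′ → a ≡ a′)

    Matching-closed : ∀ U → Directed Matching U → Matching U
    Matching-closed U common p q = let (R , m , _ , p′ , q′) = common p q in m p′ q′
  ... | R , m , _ , max with em {∀ a → ∃[ b ] T (R (a , b))} | em {∀ b → ∃[ a ] T (R (a , b))}
  ... | yes f | _     = inj₁ (mk↣ {to = proj₁ ∘ f} λ {x} {y} eq → proj₂ (m (proj₂ (f x)) (proj₂ (f y))) eq)
  ... | no _  | yes g = inj₂ (mk↣ {to = proj₁ ∘ g} λ {x} {y} eq → proj₁ (m (proj₂ (g x)) (proj₂ (g y))) eq)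
  ... | no ¬f | no ¬g = ⊥-elim (¬f λ a → by-contradiction λ a∉ → ¬g λ b → by-contradiction λ b∉ →
      let
        R′ : A × B → Bool
        R′ (x , y) = ⟦ (T (R (x , y)) ⊎ (x ≡ a × y ≡ b)) ⟧

        m′ : ∀ {x y x′ y′} → T (R′ (x , y)) → T (R′ (x′ , y′)) →
             (x ≡ x′ → y ≡ y′) × (y ≡ y′ → x ≡ x′)
        m′ p q = case ⟦ p ⟧⁻ , ⟦ q ⟧⁻ of λ where
          (inj₁ p , inj₁ q) → m p q
          (inj₁ p , inj₂ (refl , refl)) →
            (λ { refl → contradiction (_ , p) a∉ }) , (λ { refl → contradiction (_ , p) b∉ })
          (inj₂ (refl , refl) , inj₁ q) →
            (λ { refl → contradiction (_ , q) a∉ }) , (λ { refl → contradiction (_ , q) b∉ })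
          (inj₂ (refl , refl) , inj₂ (refl , refl)) → (λ _ → refl) , (λ _ → refl)
      in a∉ (b , max {R′} m′ (λ p → ⟦ inj₁ p ⟧⁺) ⟦ inj₂ (refl , refl) ⟧⁺))

  module Squaring {A : Set ℓ} (e : ℕ ↣ A) where

    Triples : Set ℓ
    Triples = A ⊎ A × A × A → Bool

    -- R encodes a set D ⊆ A together with (the graph of) a multivalued
    -- injective map D × D → D.
    record Pairing (R : Triples) : Set ℓ where
      field
        inj : ∀ {x y x′ y′ z} → T (R (inj₂ (x , y , z))) → T (R (inj₂ (x′ , y′ , z))) →
              x ≡ x′ × y ≡ y′
        tot : ∀ {x y} → T (R (inj₁ x)) → T (R (inj₁ y)) → ∃[ z ] T (R (inj₂ (x , y , z)))
        ran : ∀ {x y z} → T (R (inj₂ (x , y , z))) → T (R (inj₁ z))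

    Pairing-closed : ∀ U → Directed Pairing U → Pairing U
    Pairing-closed U common = record
      { inj = λ p q → let (_ , r , _ , p′ , q′) = common p q in Pairing.inj r p′ q′
      ; tot = λ p q → let (_ , r , R⊆U , p′ , q′) = common p q
                          (z , t) = Pairing.tot r p′ q′
                      in z , R⊆U t
      ; ran = λ p → let (_ , r , R⊆U , p′ , _) = common p p in R⊆U (Pairing.ran r p′)
      }

    -- The countable start of the maximality argument: it keeps `D` infinite, so that `doubleD` has
    -- two distinct tags.
    R₀ : Triples
    R₀ (inj₁ x)           = ⟦ (∃[ n ] x ≡ to e n) ⟧
    R₀ (inj₂ (x , y , z)) = ⟦ (∃[ m ] ∃[ n ] x ≡ to e m × y ≡ to e n × z ≡ to e (pairℕ m n)) ⟧

    R₀-Pairing : Pairing R₀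
    R₀-Pairing = record
      { inj = λ p q → case ⟦ p ⟧⁻ , ⟦ q ⟧⁻ of λ where
          ((m , n , refl , refl , eq) , (_ , _ , refl , refl , eq′)) →
            let (m≡ , n≡) = pairℕ-injective m n (injective e (trans (sym eq) eq′))
            in cong (to e) m≡ , cong (to e) n≡
      ; tot = λ p q → case ⟦ p ⟧⁻ , ⟦ q ⟧⁻ of λ where
          ((m , refl) , (n , refl)) → _ , ⟦ m , n , refl , refl , refl ⟧⁺
      ; ran = λ p → case ⟦ p ⟧⁻ of λ where
          (m , n , _ , _ , eq) → ⟦ pairℕ m n , eq ⟧⁺
      }

    module Maximal (R : Triples) (r : Pairing R) (R₀⊆R : R₀ ⊆ R)
                   (max : ∀ {S} → Pairing S → R ⊆ S → S ⊆ R) where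

      open Pairing r

      In : A → Set
      In x = T (R (inj₁ x))

      D D̅ : Set ℓ
      D = Σ A In
      D̅ = Σ A (λ x → T (not (R (inj₁ x))))

      squareD : (D × D) ↣ D
      squareD = mk↣ {to = f} f-injective
        where
        f : D × D → D
        f ((x , p) , (y , q)) = let (z , t) = tot p q in z , ran t

        f-injective : ∀ {u v} → f u ≡ f v → u ≡ v
        f-injective {(x , p) , (y , q)} {(x′ , p′) , (y′ , q′)} eq =
          let (x≡ , y≡) = inj (proj₂ (tot p q))
                (subst (λ z → T (R (inj₂ (x′ , y′ , z)))) (sym (cong proj₁ eq)) (proj₂ (tot p′ q′)))
          in cong₂ _,_ (Σ-T-≡ {b = R ∘ inj₁} x≡) (Σ-T-≡ {b = R ∘ inj₁} y≡)

      natural : ℕ → D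
      natural n = to e n , R₀⊆R ⟦ n , refl ⟧⁺

      doubleD : (D ⊎ D) ↣ D
      doubleD = doubling {a₀ = natural 0} {natural 1}
        (λ eq → case injective e (cong proj₁ eq) of λ ()) squareD

      -- If D embeds in its complement, a disjoint copy E of D can be used for
      -- the values at the pairs of (D ∪ E)² outside D².
      ¬D↣D̅ : ¬ (D ↣ D̅)
      ¬D↣D̅ h = outside (natural 0) (max R′-Pairing R⊆R′ {inj₁ _} ⟦ inj₂ (natural 0 , refl) ⟧⁺)
        where
        η : D → A
        η d = proj₁ (to h d)

        outside : ∀ d → ¬ In (η d)
        outside d p with R (inj₁ (η d)) | proj₂ (to h d)
        ... | false | _  = p
        ... | true  | ()

        η-injective : ∀ {c d} → η c ≡ η d → c ≡ d
        η-injective eq = injective h (Σ-T-≡ {b = not ∘ R ∘ inj₁} eq)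

        In′ : A → Set ℓ
        In′ x = In x ⊎ (∃[ d ] x ≡ η d)

        -- Maps `D ∪ E` into `D` by way of `D ⊎ D`. The code is read off the membership proof; a
        -- `Pairing` may be multivalued, so only injectivity has to be checked.
        code : ∀ {x} → In′ x → D
        code {x} (inj₁ p)       = to doubleD (inj₁ (x , p))
        code     (inj₂ (d , _)) = to doubleD (inj₂ d)

        code-injective : ∀ {x y} (p : In′ x) (q : In′ y) → code p ≡ code q → x ≡ y
        code-injective (inj₁ p) (inj₁ q) eq = cong proj₁ (inj₁-injective (injective doubleD eq))
        code-injective (inj₁ p) (inj₂ q) eq = case injective doubleD {inj₁ _} {inj₂ _} eq of λ ()
        code-injective (inj₂ p) (inj₁ q) eq = case injective doubleD {inj₂ _} {inj₁ _} eq of λ ()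
        code-injective (inj₂ (d , refl)) (inj₂ (d′ , refl)) eq =
          cong η (inj₂-injective (injective doubleD eq))

        New : A × A × A → Set ℓ
        New (x , y , z) = Σ[ p ∈ In′ x ] Σ[ q ∈ In′ y ]
          ¬ (In x × In y) × z ≡ η (to squareD (code p , code q))

        R′ : Triples
        R′ (inj₁ x) = ⟦ In′ x ⟧
        R′ (inj₂ t) = ⟦ (T (R (inj₂ t)) ⊎ New t) ⟧

        R⊆R′ : R ⊆ R′
        R⊆R′ {inj₁ x} p = ⟦ inj₁ p ⟧⁺
        R⊆R′ {inj₂ t} p = ⟦ inj₁ p ⟧⁺

        R′-Pairing : Pairing R′
        R′-Pairing = record
          { inj = λ p q → case ⟦ p ⟧⁻ , ⟦ q ⟧⁻ of λ where
              (inj₁ p , inj₁ q) → inj p q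
              -- Old values lie in `D` and new ones outside it, so they never coincide.
              (inj₁ p , inj₂ (_ , _ , _ , refl)) → contradiction (ran p) (outside _)
              (inj₂ (_ , _ , _ , refl) , inj₁ q) → contradiction (ran q) (outside _)
              (inj₂ (p , q , _ , refl) , inj₂ (p′ , q′ , _ , eq)) →
                let (p≡ , q≡) = ,-injective (injective squareD (η-injective eq))
                in code-injective p p′ p≡ , code-injective q q′ q≡
          ; tot = λ {x} {y} p q → case em {Lift ℓ (In x × In y)} of λ where
              (yes (lift (p , q))) → let (z , t) = tot p q in z , ⟦ inj₁ t ⟧⁺
              (no ¬pq) → _ , ⟦ inj₂ (⟦ p ⟧⁻ , ⟦ q ⟧⁻ , ¬pq ∘ lift , refl) ⟧⁺
          ; ran = λ p → case ⟦ p ⟧⁻ of λ where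
              (inj₁ p)                → ⟦ inj₁ (ran p) ⟧⁺
              (inj₂ (_ , _ , _ , eq)) → ⟦ inj₂ (_ , eq) ⟧⁺
          }

      split : A ↣ (D ⊎ D̅)
      split = mk↣ {to = f} f-injective
        where
        side : ∀ x b → R (inj₁ x) ≡ b → D ⊎ D̅
        side x true  eq = inj₁ (x , subst T (sym eq) _)
        side x false eq = inj₂ (x , subst (T ∘ not) (sym eq) _)

        f : A → D ⊎ D̅
        f x = side x _ refl

        π : D ⊎ D̅ → A
        π = [ proj₁ , proj₁ ]′

        π-side : ∀ x b eq → π (side x b eq) ≡ x
        π-side x true  eq = refl
        π-side x false eq = refl

        f-injective : ∀ {x y} → f x ≡ f y → x ≡ y
        f-injective {x} {y} eq = trans (sym (π-side x _ refl)) (trans (cong π eq) (π-side y _ refl))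

      -- As `D` does not embed in its complement, the complement embeds in `D`; then `A` embeds in
      -- `D ⊎ D`, hence in `D`, which embeds its own square.
      square : (A × A) ↣ A
      square with comparability D D̅
      ... | inj₁ h = contradiction h ¬D↣D̅
      ... | inj₂ h = ≤ᶜ-trans (A↣D ×-↣ A↣D) (≤ᶜ-trans squareD (mk↣ {to = proj₁} (Σ-T-≡ {b = R ∘ inj₁})))
        where
        D-id : D ↣ D
        D-id = mk↣ id

        A↣D : A ↣ D
        A↣D = ≤ᶜ-trans split (≤ᶜ-trans (D-id ⊎-↣ h) doubleD)

    square : (A × A) ↣ A
    square = let (R , r , R₀⊆R , max) = zorn-above Pairing Pairing-closed R₀-Pairing
             in Maximal.square R r R₀⊆R max

    double : (A ⊎ A) ↣ A
    double = doubling {a₀ = to e 0} {to e 1} (λ eq → case injective e eq of λ ()) square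

  -- Transfer of cardinal arithmetic from types to setoids

  ≤-carrier : (S : Setoid ℓ ℓ) → S ≤ᶜ setoid (Carrier S)
  ≤-carrier S = let (s , s≈) = canonical S in record
    { to        = s ⟨$⟩_
    ; cong      = Func.cong s
    ; injective = λ {x} {y} eq → S.trans (S.sym (s≈ x)) (S.trans (S.reflexive eq) (s≈ y))
    }
    where module S = Setoid S

  -- Every setoid has the cardinality of a type with propositional equality.
  Norm : Setoid ℓ ℓ → Set ℓ
  Norm S = Σ[ c ∈ Carrier S ] to (≤-carrier S) c ≡ c

  norm : (S : Setoid ℓ ℓ) → S ≈ᶜ setoid (Norm S)
  norm S = record
    { to        = rep
    ; from      = proj₁
    ; to-cong   = rep-cong
    ; from-cong = λ { refl → S.refl }
    ; inverse   = (λ {x} {y} eq → Norm-≡ (trans (Func.cong s eq) (proj₂ x)))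
                , λ { {x} refl → s≈ x }
    }
    where
    module S = Setoid S

    s : Func S (setoid (Carrier S))
    s = proj₁ (canonical S)

    s≈ : ∀ c → (s ⟨$⟩ c) S.≈ c
    s≈ = proj₂ (canonical S)

    Norm-≡ : ∀ {x y : Norm S} → proj₁ x ≡ proj₁ y → x ≡ y
    Norm-≡ {x , p} {.x , q} refl = cong (x ,_) (uip p q)

    rep : Carrier S → Norm S
    rep c = (s ⟨$⟩ c) , Func.cong s (s≈ c)

    rep-cong : ∀ {x y} → x S.≈ y → rep x ≡ rep y
    rep-cong eq = Norm-≡ (Func.cong s eq)

  ≤ᶜ-antisym : {A B : Setoid ℓ ℓ} → A ≤ᶜ B → B ≤ᶜ A → A ≈ᶜ B
  ≤ᶜ-antisym {A} {B} f g = Compose.inverse (norm A)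
    (Compose.inverse (cantor-bernstein em (normalise f) (normalise g)) (Symmetry.inverse (norm B)))
    where
    normalise : {A B : Setoid ℓ ℓ} → A ≤ᶜ B → Norm A ↣ Norm B
    normalise {A} {B} f = ≤ᶜ-trans (Inverse⇒Injection (Symmetry.inverse (norm A)))
      (≤ᶜ-trans f (Inverse⇒Injection (norm B)))

-- Structures whose sort P is a field of subsets of K

image-≈ᶜ : ∀ {ℓ} {A B : Setoid ℓ ℓ} (f : A ≤ᶜ B) →
           A ≈ᶜ subsetoid B (λ y → ∃[ x ] Setoid._≈_ B (to f x) y)
image-≈ᶜ {A = A} {B} f = record
  { to        = λ x → to f x , x , B.refl
  ; from      = λ (_ , x , _) → x
  ; to-cong   = Injection.cong f
  ; from-cong = λ { {_ , _ , p} {_ , _ , q} eq → injective f (B.trans p (B.trans eq (B.sym q))) }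
  ; inverse   = (λ { {_ , _ , p} eq → B.trans (Injection.cong f eq) p })
              , λ { {_} {_ , _ , p} eq → injective f (B.trans p eq) }
  }
  where module B = Setoid B

module _ {ℓ : Level} {χ : Setoid ℓ ℓ} where

  -- An embedding given by maps, without its image. The field `strong` is the contrapositive of the
  -- finiteness condition: a set that gains a point is already infinite in `M`.
  record StrongMap (M N : Structure χ) : Set ℓ where
    private
      module M = Structure M
      module N = Structure N
    field
      onK : M.K ≤ᶜ N.K
      onP : M.P ≤ᶜ N.P
      onQ : M.Q ≤ᶜ N.Q
      𝟏-homo : to onP M.𝟏 N.P.≈ N.𝟏
      ᶜ-homo : ∀ X → to onP (X M.ᶜ) N.P.≈ (to onP X) N.ᶜ
      ∩-homo : ∀ A → to onP (M.∩ A) N.P.≈ N.∩ (to onQ A)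
      π-homo : ∀ α A → to onP (M.π α A) N.P.≈ N.π α (to onQ A)
      ∧-homo : ∀ X Y → to onP (X M.∧ Y) N.P.≈ (to onP X N.∧ to onP Y)
      ∨-homo : ∀ X Y → to onP (X M.∨ Y) N.P.≈ (to onP X N.∨ to onP Y)
      ε-homo : ∀ x X → (x M.ε X) ⇔ (to onK x N.ε to onP X)
      strong : ∀ X y → y N.ε to onP X →
               (∃[ x ] to onK x N.K.≈ y) ⊎ setoid ℕ ≤ᶜ subsetoid M.K (M.hat X)

  embedding : {M N : Structure χ} → StrongMap M N → Embedding χ M N
  embedding {M} {N} f = record
    { image  = image
    ; strong = λ (Y , X , fX≈Y) fin →
          proj₂
        , λ {y} yεY → case strong X y (N.ε-resp N.K.refl (N.P.sym fX≈Y) yεY) of λ where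
            (inj₁ y∈) → y∈ , yεY
            (inj₂ e)  → contradiction fin (ℕ≤⇒Infinite (≤ᶜ-trans e (into X fX≈Y)))
    ; iso    = record
      { isoK   = image-≈ᶜ onK
      ; isoP   = image-≈ᶜ onP
      ; isoQ   = image-≈ᶜ onQ
      ; 𝟏-homo = 𝟏-homo
      ; ᶜ-homo = ᶜ-homo
      ; ∩-homo = ∩-homo
      ; π-homo = π-homo
      ; ∧-homo = ∧-homo
      ; ∨-homo = ∨-homo
      ; ε-homo = ε-homo
      }
    }
    where
    open StrongMap f
    module M = Structure M
    module N = Structure N

    image : Substructure χ N
    image = record
      { inK      = λ y → ∃[ x ] to onK x N.K.≈ y
      ; inP      = λ Y → ∃[ X ] to onP X N.P.≈ Y
      ; inQ      = λ B → ∃[ A ] to onQ A N.Q.≈ B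
      ; inK-resp = λ eq (x , p) → x , N.K.trans p eq
      ; inP-resp = λ eq (x , p) → x , N.P.trans p eq
      ; inQ-resp = λ eq (x , p) → x , N.Q.trans p eq
      ; 𝟏-closed = M.𝟏 , 𝟏-homo
      ; ᶜ-closed = λ (X , p) → X M.ᶜ , N.P.trans (ᶜ-homo X) (N.ᶜ-cong p)
      ; ∩-closed = λ (A , p) → M.∩ A , N.P.trans (∩-homo A) (N.∩-cong p)
      ; π-closed = λ α (A , p) → M.π α A , N.P.trans (π-homo α A) (N.π-cong (Setoid.refl χ) p)
      ; ∧-closed = λ (X , p) (Y , q) → X M.∧ Y , N.P.trans (∧-homo X Y) (N.∧-cong p q)
      ; ∨-closed = λ (X , p) (Y , q) → X M.∨ Y , N.P.trans (∨-homo X Y) (N.∨-cong p q)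
      }

    module I = Structure (Substructure.structure image)

    -- Carries a sequence of distinct members of `X` into the image structure, where finiteness is
    -- assumed.
    into : ∀ X {Y} (p : to onP X N.P.≈ Y) →
           subsetoid M.K (M.hat X) ≤ᶜ subsetoid I.K (I.hat (Y , X , p))
    into X p = record
      { to        = λ (x , xεX) → (to onK x , x , N.K.refl) , N.ε-resp N.K.refl p (⇒ (ε-homo x X) xεX)
      ; cong      = Injection.cong onK
      ; injective = injective onK
      }

-- Boolean terms in generators and singletons

data Expr {ℓ} (I K : Set ℓ) : Set ℓ where
  gen       : I → Expr I K
  single    : K → Expr I K
  full      : Expr I K
  compl     : Expr I K → Expr I K
  meet join : (X Y : Expr I K) → Expr I K

mapᵉ : ∀ {ℓ} {I I′ K K′ : Set ℓ} → (I → I′) → (K → K′) → Expr I K → Expr I′ K′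
mapᵉ r h (gen i)    = gen (r i)
mapᵉ r h (single k) = single (h k)
mapᵉ r h full       = full
mapᵉ r h (compl X)  = compl (mapᵉ r h X)
mapᵉ r h (meet X Y) = meet (mapᵉ r h X) (mapᵉ r h Y)
mapᵉ r h (join X Y) = join (mapᵉ r h X) (mapᵉ r h Y)

-- The top layer of a term whose immediate subterms are already coded in `A`; an injection of such
-- layers into `A` codes all terms by recursion.
Shape : ∀ {ℓ} → Set ℓ → Set ℓ → Set ℓ → Set ℓ
Shape {ℓ} I K A = (I ⊎ K) ⊎ ((⊤ {ℓ} ⊎ A) ⊎ (A × A ⊎ A × A))

module _ {ℓ} {A I K : Set ℓ} (f : Shape I K A ↣ A) where

  code : Expr I K → A
  code (gen i)    = to f (inj₁ (inj₁ i))
  code (single k) = to f (inj₁ (inj₂ k))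
  code full       = to f (inj₂ (inj₁ (inj₁ tt)))
  code (compl X)  = to f (inj₂ (inj₁ (inj₂ (code X))))
  code (meet X Y) = to f (inj₂ (inj₂ (inj₁ (code X , code Y))))
  code (join X Y) = to f (inj₂ (inj₂ (inj₂ (code X , code Y))))

  private
    shape : Expr I K → Shape I K A
    shape (gen i)    = inj₁ (inj₁ i)
    shape (single k) = inj₁ (inj₂ k)
    shape full       = inj₂ (inj₁ (inj₁ tt))
    shape (compl X)  = inj₂ (inj₁ (inj₂ (code X)))
    shape (meet X Y) = inj₂ (inj₂ (inj₁ (code X , code Y)))
    shape (join X Y) = inj₂ (inj₂ (inj₂ (code X , code Y)))

    code-shape : ∀ X → code X ≡ to f (shape X)
    code-shape (gen i)    = refl
    code-shape (single k) = refl
    code-shape full       = refl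
    code-shape (compl X)  = refl
    code-shape (meet X Y) = refl
    code-shape (join X Y) = refl

    shape-injective : ∀ X Y → shape X ≡ shape Y → X ≡ Y

    code-injective : ∀ X Y → code X ≡ code Y → X ≡ Y
    code-injective X Y eq = shape-injective X Y
      (injective f (trans (sym (code-shape X)) (trans eq (code-shape Y))))

    shape-injective (gen i)    (gen .i)     refl = refl
    shape-injective (single k) (single .k)  refl = refl
    shape-injective full       full         _    = refl
    shape-injective (compl X)  (compl Y)    p    = cong compl (code-injective X Y
      (inj₂-injective (inj₁-injective (inj₂-injective p))))
    shape-injective (meet X Y) (meet X′ Y′) p    =
      let (p , q) = ,-injective (inj₁-injective (inj₂-injective (inj₂-injective p)))
      in cong₂ meet (code-injective X X′ p) (code-injective Y Y′ q)
    shape-injective (join X Y) (join X′ Y′) p    =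
      let (p , q) = ,-injective (inj₂-injective (inj₂-injective (inj₂-injective p)))
      in cong₂ join (code-injective X X′ p) (code-injective Y Y′ q)

  code-↣ : Expr I K ↣ A
  code-↣ = mk↣ {to = code} (λ {X} {Y} → code-injective X Y)

-- The model given by a field of sets

module FieldOfSets {ℓ} (em : ExcludedMiddle ℓ) {I K : Set ℓ} (gens : I → K → Bool) where

  open Classical em

  eval : Expr I K → K → Bool
  eval (gen i)    x = gens i x
  eval (single k) x = ⟦ x ≡ k ⟧
  eval full       x = true
  eval (compl X)  x = not (eval X x)
  eval (meet X Y) x = eval X x ∧ eval Y x
  eval (join X Y) x = eval X x ∨ eval Y x

  infix 4 _≋_
  _≋_ : Expr I K → Expr I K → Set ℓ
  X ≋ Y = ∀ x → eval X x ≡ eval Y x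

  sets : Setoid ℓ ℓ
  sets = record
    { Carrier       = Expr I K
    ; _≈_           = _≋_
    ; isEquivalence = record
      { refl  = λ _ → refl
      ; sym   = λ p x → sym (p x)
      ; trans = λ p q x → trans (p x) (q x)
      }
    }

  isBooleanAlgebra : IsBooleanAlgebra _≋_ join meet compl full (compl full)
  isBooleanAlgebra = record
    { isDistributiveLattice = record
      { isLattice   = record
        { isEquivalence = Setoid.isEquivalence sets
        ; ∨-comm        = λ X Y x → B.∨-comm (eval X x) (eval Y x)
        ; ∨-assoc       = λ X Y Z x → B.∨-assoc (eval X x) (eval Y x) (eval Z x)
        ; ∨-cong        = λ p q x → cong₂ _∨_ (p x) (q x)
        ; ∧-comm        = λ X Y x → B.∧-comm (eval X x) (eval Y x)
        ; ∧-assoc       = λ X Y Z x → B.∧-assoc (eval X x) (eval Y x) (eval Z x)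
        ; ∧-cong        = λ p q x → cong₂ _∧_ (p x) (q x)
        ; absorptive    = (λ X Y x → proj₁ B.absorptive (eval X x) (eval Y x))
                        , (λ X Y x → proj₂ B.absorptive (eval X x) (eval Y x))
        }
      ; ∨-distrib-∧ = (λ X Y Z x → B.∨-distribˡ-∧ (eval X x) (eval Y x) (eval Z x))
                    , (λ X Y Z x → B.∨-distribʳ-∧ (eval X x) (eval Y x) (eval Z x))
      ; ∧-distrib-∨ = (λ X Y Z x → B.∧-distribˡ-∨ (eval X x) (eval Y x) (eval Z x))
                    , (λ X Y Z x → B.∧-distribʳ-∨ (eval X x) (eval Y x) (eval Z x))
      }
    ; ∨-complement = (λ X x → B.∨-complementˡ (eval X x)) , (λ X x → B.∨-complementʳ (eval X x))
    ; ∧-complement = (λ X x → B.∧-complementˡ (eval X x)) , (λ X x → B.∧-complementʳ (eval X x))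
    ; ¬-cong       = λ p x → cong not (p x)
    }
    where module B = IsBooleanAlgebra ∨-∧-isBooleanAlgebra

  -- Data interpreting the sort `Q`. Congruence of `∩` is derived from `∩-spec` and `π-cong`.
  record Sequences (χ : Setoid ℓ ℓ) : Set (Level.suc ℓ) where
    private module χ = Setoid χ
    field
      Q           : Setoid ℓ ℓ
      ∩           : Carrier Q → Expr I K
      π           : χ.Carrier → Carrier Q → Expr I K
      π-cong      : ∀ {α β A B} → α χ.≈ β → Setoid._≈_ Q A B → π α A ≋ π β B
      π-injective : ∀ {A B} → (∀ α → π α A ≋ π α B) → Setoid._≈_ Q A B
      ∩-spec      : ∀ A x → T (eval (∩ A) x) ⇔ (∀ α → T (eval (π α A) x))

  module _ {χ : Setoid ℓ ℓ} (𝒮 : Sequences χ) where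

    open Sequences 𝒮

    model : Structure χ
    model = record
      { K      = setoid K
      ; P      = sets
      ; Q      = Q
      ; 𝟏      = full
      ; _ᶜ     = compl
      ; ∩      = ∩
      ; π      = π
      ; _∧_    = meet
      ; _∨_    = join
      ; _ε_    = λ x X → Lift ℓ (T (eval X x))
      ; ᶜ-cong = λ p x → cong not (p x)
      ; ∩-cong = λ {A} {B} A≈B x → T-ext
          (λ t → ⇐ (∩-spec B x) λ α → subst T (π-cong (Setoid.refl χ) A≈B x) (⇒ (∩-spec A x) t α))
          (λ t → ⇐ (∩-spec A x) λ α → subst T (sym (π-cong (Setoid.refl χ) A≈B x)) (⇒ (∩-spec B x) t α))
      ; π-cong = π-cong
      ; ∧-cong = λ p q x → cong₂ _∧_ (p x) (q x)
      ; ∨-cong = λ p q x → cong₂ _∨_ (p x) (q x)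
      ; ε-resp = λ { {x} refl X≋Y (lift t) → lift (subst T (X≋Y x) t) }
      }

    model-⊨ψ : _⊨ψ χ model
    model-⊨ψ = record
      { extensional      = λ X Y h x → T-ext (lower ∘ ⇒ (h x) ∘ lift) (lower ∘ ⇐ (h x) ∘ lift)
      ; isBooleanAlgebra = isBooleanAlgebra
      ; ε-𝟏              = _
      ; ε-ᶜ              = λ x X → T-compl (eval X x)
      ; ε-∧              = λ x X Y → mk⇔
          (λ (lift t) → let (p , q) = ⇒ (T-∧ {eval X x}) t in lift p , lift q)
          (λ (lift p , lift q) → lift (⇐ (T-∧ {eval X x}) (p , q)))
      ; ε-∨              = λ x X Y → mk⇔
          (λ (lift t) → [ inj₁ ∘ lift , inj₂ ∘ lift ]′ (⇒ (T-∨ {eval X x}) t))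
          [ (λ (lift p) → lift (⇐ (T-∨ {eval X x}) (inj₁ p)))
          , (λ (lift q) → lift (⇐ (T-∨ {eval X x}) (inj₂ q))) ]′
      ; singletons       = λ x → single x , λ z → mk⇔ (⟦_⟧⁻ ∘ lower) (lift ∘ ⟦_⟧⁺)
      ; π-extensional    = λ A B → mk⇔ (λ A≈B α → π-cong (Setoid.refl χ) A≈B) π-injective
      ; ε-∩              = λ A x → mk⇔
          (λ (lift t) α → lift (⇒ (∩-spec A x) t α))
          (λ h → lift (⇐ (∩-spec A x) (lower ∘ h)))
      }
      where
      T-compl : ∀ b → Lift ℓ (T (not b)) ⇔ (¬ Lift ℓ (T b))
      T-compl true  = mk⇔ (λ ()) (λ ¬t → ⊥-elim (¬t _))
      T-compl false = mk⇔ (λ _ ()) _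

  noSequences : ∀ {χ} → Sequences χ
  noSequences = record
    { Q           = setoid ⊥
    ; ∩           = λ ()
    ; π           = λ _ ()
    ; π-cong      = λ { {A = ()} }
    ; π-injective = λ { {()} }
    ; ∩-spec      = λ ()
    }

-- Strong maps between fields of sets

module _ {ℓ} (em : ExcludedMiddle ℓ)
  {I J K L : Set ℓ} {gens : I → K → Bool} {gens′ : J → L → Bool}
  (r : I → J) (h : K ↣ L) (gens-≡ : ∀ i x → gens′ (r i) (to h x) ≡ gens i x)
  where

  open Classical em
  private
    module M = FieldOfSets em gens
    module N = FieldOfSets em gens′

  -- Induction on the term; injectivity of `h` settles the singletons.
  eval-mapᵉ : ∀ X x → N.eval (mapᵉ r (to h) X) (to h x) ≡ M.eval X x
  eval-mapᵉ (gen i)    x = gens-≡ i x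
  eval-mapᵉ (single k) x = T-ext
    (λ t → ⟦ injective h ⟦ t ⟧⁻ ⟧⁺) (λ t → ⟦ cong (to h) ⟦ t ⟧⁻ ⟧⁺)
  eval-mapᵉ full       x = refl
  eval-mapᵉ (compl X)  x = cong not (eval-mapᵉ X x)
  eval-mapᵉ (meet X Y) x = cong₂ _∧_ (eval-mapᵉ X x) (eval-mapᵉ Y x)
  eval-mapᵉ (join X Y) x = cong₂ _∨_ (eval-mapᵉ X x) (eval-mapᵉ Y x)

  -- By `eval-mapᵉ` everything is controlled on the range of `h`; the two hypotheses take care of
  -- the points outside it.
  mapᵉ-strong : {χ : Setoid ℓ ℓ} (𝒯 : N.Sequences χ) →
    (∀ {X Y} → X M.≋ Y → mapᵉ r (to h) X N.≋ mapᵉ r (to h) Y) →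
    (∀ X y → T (N.eval (mapᵉ r (to h) X) y) →
       (∃[ x ] to h x ≡ y) ⊎ setoid ℕ ≤ᶜ subsetoid (setoid K) (λ x → Lift ℓ (T (M.eval X x)))) →
    StrongMap (M.model M.noSequences) (N.model 𝒯)
  mapᵉ-strong 𝒯 mapᵉ-cong st = record
    { onK    = h
    ; onP    = record
      { to        = mapᵉ r (to h)
      ; cong      = λ {X} {Y} → mapᵉ-cong {X} {Y}
      ; injective = λ {X} {Y} eq x →
          trans (sym (eval-mapᵉ X x)) (trans (eq (to h x)) (eval-mapᵉ Y x))
      }
    ; onQ    = record { to = λ () ; cong = λ { {()} } ; injective = λ { {()} } }
    ; 𝟏-homo = λ _ → refl
    ; ᶜ-homo = λ _ _ → refl
    ; ∩-homo = λ ()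
    ; π-homo = λ _ ()
    ; ∧-homo = λ _ _ _ → refl
    ; ∨-homo = λ _ _ _ → refl
    ; ε-homo = λ x X → mk⇔ (λ (lift t) → lift (subst T (sym (eval-mapᵉ X x)) t))
                           (λ (lift t) → lift (subst T (eval-mapᵉ X x) t))
    ; strong = λ X y (lift t) → st X y t
    }

module _ {ℓ} (em : ExcludedMiddle ℓ) (ac : AxiomOfChoice ℓ) {A : Set ℓ} (e : ℕ ↣ A) where

  open Choice em ac
  open Squaring em ac e

  Expr-↣ : {I K : Set ℓ} → I ↣ A → K ↣ A → Expr I K ↣ A
  Expr-↣ i k = code-↣ (≤ᶜ-trans
    (≤ᶜ-trans (i ⊎-↣ k) double ⊎-↣
     ≤ᶜ-trans
       (≤ᶜ-trans (mk↣ {to = λ _ → to e 0} (λ _ → refl) ⊎-↣ mk↣ id) double ⊎-↣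
        ≤ᶜ-trans (square ⊎-↣ square) double)
       double)
    double)

-- A set of the old model receives the new point iff it contains almost all
-- terms of the sequence a.
module NewPoint {ℓ} (em : ExcludedMiddle ℓ)
  {I K : Set ℓ} {gens : I → K → Bool} {gens′ : I → K ⊎ ⊤ {ℓ} → Bool}
  (gens-≡ : ∀ i x → gens′ i (inj₁ x) ≡ gens i x) (a : ℕ ↣ K)
  (gens-a : ∀ i n → gens i (to a n) ≡ gens′ i (inj₂ tt))
  where

  open Classical em

  private
    module M = FieldOfSets em gens
    module N = FieldOfSets em gens′

  old : K ↣ (K ⊎ ⊤ {ℓ})
  old = mk↣ {to = inj₁} inj₁-injective

  ext : Expr I K → Expr I (K ⊎ ⊤ {ℓ})
  ext = mapᵉ id inj₁

  -- Generators do not distinguish the terms of `a` from the new point, a singleton meets the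
  -- injective sequence at most once, and binary operations take the larger threshold.
  tail : ∀ X → ∃[ n ] (∀ m → n ≤ m → M.eval X (to a m) ≡ N.eval (ext X) (inj₂ tt))
  tail (gen i)    = 0 , λ m _ → gens-a i m
  tail (single k) = let (n , ≢k) = avoid in n , λ m n≤m → T-ext
      (λ t → contradiction ⟦ t ⟧⁻ (≢k m n≤m))
      (λ t → case ⟦ t ⟧⁻ of λ ())
    where
    avoid : ∃[ n ] (∀ m → n ≤ m → to a m ≢ k)
    avoid with em {∃[ n ] to a n ≡ k}
    ... | yes (n , an≡k) = suc n , λ m n<m am≡k → <-irrefl (injective a (trans an≡k (sym am≡k))) n<m
    ... | no ¬p          = 0 , λ m _ eq → ¬p (m , eq)
  tail full       = 0 , λ _ _ → refl
  tail (compl X)  = let (n , p) = tail X in n , λ m n≤m → cong not (p m n≤m)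
  tail (meet X Y) = let (n , p) = tail X ; (n′ , q) = tail Y in n ℕ.⊔ n′ , λ m le →
    cong₂ _∧_ (p m (≤-trans (m≤m⊔n n n′) le)) (q m (≤-trans (m≤n⊔m n n′) le))
  tail (join X Y) = let (n , p) = tail X ; (n′ , q) = tail Y in n ℕ.⊔ n′ , λ m le →
    cong₂ _∨_ (p m (≤-trans (m≤m⊔n n n′) le)) (q m (≤-trans (m≤n⊔m n n′) le))

  ext-cong : ∀ {X Y} → X M.≋ Y → ext X N.≋ ext Y
  ext-cong {X} {Y} X≋Y (inj₁ x) = trans (eval-mapᵉ em id old gens-≡ X x)
    (trans (X≋Y x) (sym (eval-mapᵉ em id old gens-≡ Y x)))
  ext-cong {X} {Y} X≋Y (inj₂ _) =
    -- Beyond both thresholds, a term of `a` stands in for the new point.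
    let (n , p) = tail X ; (n′ , q) = tail Y ; m = n ℕ.⊔ n′
    in trans (sym (p m (m≤m⊔n n n′))) (trans (X≋Y (to a m)) (q m (m≤n⊔m n n′)))

  ext-strong : ∀ {χ} → StrongMap {χ = χ} (M.model M.noSequences) (N.model N.noSequences)
  ext-strong = mapᵉ-strong em id old gens-≡ N.noSequences
    (λ {X} {Y} → ext-cong {X} {Y}) λ where
      X (inj₁ x) t → inj₁ (x , refl)
      -- A set that receives the new point contains the terms of `a` from index `n` on, so it was
      -- infinite.
      X (inj₂ _) t → let (n , p) = tail X in inj₂ (record
        { to        = λ m → to a (n + m) , lift (subst T (sym (p (n + m) (m≤m+n n m))) t)
        ; cong      = λ { refl → refl }
        ; injective = λ {x} {y} eq → +-cancelˡ-≡ n x y (injective a eq)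
        })

-- Power sets

module _ {ℓ} (em : ExcludedMiddle ℓ) where

  open Classical em

  -- A subset is sent to its direct image under the injection, closed under `_≈_`.
  2^-mono : {A B : Setoid ℓ ℓ} → A ≤ᶜ B → 2^ A ≤ᶜ 2^ B
  2^-mono {A} {B} i = record
    { to        = image
    ; cong      = λ {f} {g} f≈g y → T-ext (transfer {f} {g} f≈g) (transfer {g} {f} (sym ∘ f≈g))
    ; injective = λ {f} {g} eq x → T-ext
        (reflect {f} {g} (eq (to i x))) (reflect {g} {f} (sym (eq (to i x))))
    }
    where
    module A = Setoid A
    module B = Setoid B

    Image : Carrier (2^ A) → B.Carrier → Set ℓ
    Image f y = ∃[ x ] to i x B.≈ y × T (f ⟨$⟩ x)

    image : Carrier (2^ A) → Carrier (2^ B)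
    image f = record
      { to   = λ y → ⟦ Image f y ⟧
      ; cong = λ y≈y′ → T-ext
          (λ t → let (x , p , q) = ⟦ t ⟧⁻ in ⟦ x , B.trans p y≈y′ , q ⟧⁺)
          (λ t → let (x , p , q) = ⟦ t ⟧⁻ in ⟦ x , B.trans p (B.sym y≈y′) , q ⟧⁺)
      }

    transfer : ∀ {f g y} → (∀ x → f ⟨$⟩ x ≡ g ⟨$⟩ x) → T ⟦ Image f y ⟧ → T ⟦ Image g y ⟧
    transfer f≈g t = let (x , p , q) = ⟦ t ⟧⁻ in ⟦ x , p , subst T (f≈g x) q ⟧⁺

    reflect : ∀ {f g x} → ⟦ Image f (to i x) ⟧ ≡ ⟦ Image g (to i x) ⟧ → T (f ⟨$⟩ x) → T (g ⟨$⟩ x)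
    reflect {f} {g} {x} eq t =
      let (x′ , p , q) = ⟦ subst T eq ⟦ x , B.refl , t ⟧⁺ ⟧⁻
      in subst T (Func.cong g (injective i p)) q

  ≤-2^ : (A : Setoid ℓ ℓ) → A ≤ᶜ 2^ A
  ≤-2^ A = record
    { to        = λ x → record
      { to   = λ y → ⟦ x A.≈ y ⟧
      ; cong = λ y≈y′ → T-ext (λ t → ⟦ A.trans ⟦ t ⟧⁻ y≈y′ ⟧⁺)
                              (λ t → ⟦ A.trans ⟦ t ⟧⁻ (A.sym y≈y′) ⟧⁺)
      }
    ; cong      = λ x≈x′ y → T-ext (λ t → ⟦ A.trans (A.sym x≈x′) ⟦ t ⟧⁻ ⟧⁺)
                                   (λ t → ⟦ A.trans x≈x′ ⟦ t ⟧⁻ ⟧⁺)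
    ; injective = λ {x} {y} eq → A.sym ⟦ subst T (eq x) ⟦ A.refl ⟧⁺ ⟧⁻
    }
    where module A = Setoid A

-- The failure of amalgamation

module Construction {ℓ} (em : ExcludedMiddle ℓ) (ac : AxiomOfChoice ℓ)
  (χ κ : Setoid ℓ ℓ) (χ-infinite : Infinite χ) (2^χ≤κ : 2^ χ ≤ᶜ κ) where

  open Classical em
  open Choice em ac
  private module χ = Setoid χ

  N[_] : Setoid ℓ ℓ → Set ℓ
  N[_] = Norm em ac

  rep : (S : Setoid ℓ ℓ) → Carrier S → N[ S ]
  rep S = Inverse.to (norm em ac S)

  C Γ k : Set ℓ
  C = N[ χ ]
  Γ = N[ 2^ χ ]
  k = N[ κ ]

  fromN : ∀ S → setoid N[ S ] ≤ᶜ S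
  fromN S = Inverse⇒Injection (Symmetry.inverse (norm em ac S))

  toN : ∀ S → S ≤ᶜ setoid N[ S ]
  toN S = Inverse⇒Injection (norm em ac S)

  Γ↣k : Γ ↣ k
  Γ↣k = ≤ᶜ-trans (fromN (2^ χ)) (≤ᶜ-trans 2^χ≤κ (toN κ))

  C↣k : C ↣ k
  C↣k = ≤ᶜ-trans (fromN χ) (≤ᶜ-trans (≤-2^ em χ) (≤ᶜ-trans 2^χ≤κ (toN κ)))

  ℕ≤χ : setoid ℕ ≤ᶜ χ
  ℕ≤χ = Infinite⇒ℕ≤ em χ χ-infinite

  ℕ↣Γ : ℕ ↣ Γ
  ℕ↣Γ = ≤ᶜ-trans ℕ≤χ (≤ᶜ-trans (≤-2^ em χ) (toN (2^ χ)))

  ℕ↣k : ℕ ↣ k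
  ℕ↣k = ≤ᶜ-trans ℕ↣Γ Γ↣k

  double : (k ⊎ k) ↣ k
  double = Squaring.double em ac ℕ↣k

  point : ⊤ {ℓ} ↣ k
  point = mk↣ {to = λ _ → to ℕ↣k 0} (λ _ → refl)

  ⊎ₛ-≤k : {A B : Setoid ℓ ℓ} → A ≤ᶜ setoid k → B ≤ᶜ setoid k → (A ⊎ₛ B) ≤ᶜ setoid k
  ⊎ₛ-≤k f g = ≤ᶜ-trans (f ⊎-injection g) (≤ᶜ-trans (Inverse⇒Injection (Pointwise-≡↔≡ k k)) double)

  module _ {I K : Set ℓ} (gens : I → K → Bool) (𝒮 : FieldOfSets.Sequences em gens χ)
    (I↣k : I ↣ k) (K↣k : K ↣ k) (k↣K : k ↣ K)
    (Q≤k : FieldOfSets.Sequences.Q 𝒮 ≤ᶜ setoid k)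
    where

    open FieldOfSets em gens

    P≤k : sets ≤ᶜ setoid k
    P≤k = ≤ᶜ-trans (≤-carrier em ac sets) (Expr-↣ em ac ℕ↣k I↣k K↣k)

    -- Each of the three sorts embeds in `k`, and `k` embeds in the sort `K`; Cantor-Bernstein does
    -- the rest.
    universe≈κ : Structure.universe (model 𝒮) ≈ᶜ κ
    universe≈κ = ≤ᶜ-antisym em ac
      (≤ᶜ-trans (⊎ₛ-≤k K↣k (⊎ₛ-≤k P≤k Q≤k)) (fromN κ))
      (≤ᶜ-trans (toN κ) (≤ᶜ-trans k↣K
        (record { to = inj₁ ; cong = inj₁ ; injective = λ { (inj₁ p) → p } })))

    member : 𝐊 χ
    member = record
      { structure = model 𝒮
      ; models    = model-⊨ψ 𝒮
      ; large     = ≤ᶜ-trans (≤-2^ em χ) (≤ᶜ-trans 2^χ≤κ (Inverse⇒Injection (Symmetry.inverse universe≈κ)))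
      }

  -- The summand `k` consists of padding points outside `Γ`, which bring the size up to `κ`.
  K₀ K₁ : Set ℓ
  K₀ = Γ ⊎ k
  K₁ = K₀ ⊎ ⊤ {ℓ}

  gens₀ : ⊤ {ℓ} → K₀ → Bool
  gens₀ _ (inj₁ _) = true
  gens₀ _ (inj₂ _) = false

  gens₁ : ⊤ {ℓ} → K₁ → Bool
  gens₁ i (inj₁ x) = gens₀ i x
  gens₁ _ (inj₂ _) = true

  -- `nothing` stands for the old generator `Γ`, the other indices for the coordinate sets.
  gens₂ : Maybe C → K₀ → Bool
  gens₂ nothing  x        = gens₀ tt x
  gens₂ (just α) (inj₁ g) = proj₁ g ⟨$⟩ proj₁ α
  gens₂ (just α) (inj₂ _) = false

  module F₀ = FieldOfSets em gens₀
  module F₁ = FieldOfSets em gens₁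
  module F₂ = FieldOfSets em gens₂

  Γ-ext : ∀ {g h : Γ} → (∀ α → proj₁ g ⟨$⟩ α ≡ proj₁ h ⟨$⟩ α) → g ≡ h
  Γ-ext = injective (fromN (2^ χ))

  coordinate : χ.Carrier → Bool → Expr (Maybe C) K₀
  coordinate α true  = gen (just (rep χ α))
  coordinate α false = compl (gen (just (rep χ α)))

  -- The meet with `Γ` removes the padding points, all of which lie in `coordinate α false`.
  cylinder : χ.Carrier → Bool → Expr (Maybe C) K₀
  cylinder α b = meet (gen nothing) (coordinate α b)

  rep-χ : ∀ α → proj₁ (rep χ α) χ.≈ α
  rep-χ α = Inverse.strictlyInverseʳ (norm em ac χ) α

  eval-coordinate : ∀ α b g → T (F₂.eval (coordinate α b) (inj₁ g)) ⇔ (proj₁ g ⟨$⟩ α ≡ b)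
  eval-coordinate α true  g = mk⇔
    (λ t → trans (Func.cong (proj₁ g) (χ.sym (rep-χ α))) (⇒ T-≡ t))
    (λ eq → ⇐ T-≡ (trans (Func.cong (proj₁ g) (rep-χ α)) eq))
  eval-coordinate α false g = mk⇔
    (λ t → trans (Func.cong (proj₁ g) (χ.sym (rep-χ α))) (⇒ T-not-≡ t))
    (λ eq → ⇐ T-not-≡ (trans (Func.cong (proj₁ g) (rep-χ α)) eq))

  coordinate-cong : ∀ {α β b c} → α χ.≈ β → b ≡ c → coordinate α b ≡ coordinate β c
  coordinate-cong {b = true}  α≈β refl = cong (gen ∘ just) (Inverse.to-cong (norm em ac χ) α≈β)
  coordinate-cong {b = false} α≈β refl = cong (compl ∘ gen ∘ just) (Inverse.to-cong (norm em ac χ) α≈β)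

  threads : F₂.Sequences χ
  threads = record
    { Q           = setoid Γ
    ; ∩           = λ g → single (inj₁ g)
    ; π           = λ α g → cylinder α (proj₁ g ⟨$⟩ α)
    ; π-cong      = λ { {α} {β} {g} {.g} α≈β refl x →
        cong (λ X → F₂.eval (meet (gen nothing) X) x) (coordinate-cong α≈β (Func.cong (proj₁ g) α≈β)) }
    ; π-injective = λ {g} {h} eq → Γ-ext λ α →
        ⇒ (eval-coordinate α (proj₁ h ⟨$⟩ α) g)
          (subst T (eq α (inj₁ g)) (⇐ (eval-coordinate α (proj₁ g ⟨$⟩ α) g) refl))
    ; ∩-spec      = λ where
        g (inj₁ h) → mk⇔
          (λ t α → ⇐ (eval-coordinate α (proj₁ g ⟨$⟩ α) h)
            (cong (λ f → proj₁ f ⟨$⟩ α) (inj₁-injective ⟦ t ⟧⁻)))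
          (λ t → ⟦ cong inj₁ (Γ-ext λ α → ⇒ (eval-coordinate α (proj₁ g ⟨$⟩ α) h) (t α)) ⟧⁺)
        g (inj₂ _) → mk⇔ (λ t → case ⟦ t ⟧⁻ of λ ())
          -- A padding point is in no cylinder; an index at which to see this exists because `χ` is
          -- infinite.
          (λ t → ⊥-elim (t (to ℕ≤χ 0)))
    }

  K₀↣k : K₀ ↣ k
  K₀↣k = ≤ᶜ-trans (Γ↣k ⊎-↣ mk↣ id) double

  K₁↣k : K₁ ↣ k
  K₁↣k = ≤ᶜ-trans (K₀↣k ⊎-↣ point) double

  Maybe↣k : Maybe C ↣ k
  Maybe↣k = ≤ᶜ-trans (mk↣ {to = f} f-injective) (≤ᶜ-trans (C↣k ⊎-↣ point) double)
    where
    f : Maybe C → C ⊎ ⊤ {ℓ}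
    f = maybe inj₁ (inj₂ tt)

    f-injective : ∀ {x y} → f x ≡ f y → x ≡ y
    f-injective {just _}  {just _}  refl = refl
    f-injective {nothing} {nothing} refl = refl

  k↣K₀ : k ↣ K₀
  k↣K₀ = mk↣ inj₂-injective

  k↣K₁ : k ↣ K₁
  k↣K₁ = ≤ᶜ-trans k↣K₀ (mk↣ inj₁-injective)

  none : setoid (⊥ {ℓ}) ≤ᶜ setoid k
  none = record { to = λ () ; cong = λ { {()} } ; injective = λ { {()} } }

  -- The three models and the two inclusions

  M₀ M₁ M₂ : 𝐊 χ
  M₀ = member gens₀ F₀.noSequences point K₀↣k k↣K₀ none
  M₁ = member gens₁ F₁.noSequences point K₁↣k k↣K₁ none
  M₂ = member gens₂ threads Maybe↣k K₀↣k k↣K₀ Γ↣k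

  i₁ : _↪_ χ M₀ M₁
  i₁ = embedding (NewPoint.ext-strong em {gens = gens₀} {gens₁} (λ _ _ → refl)
    -- The sequence runs through distinct elements of `Γ`, which belong to the single generator just
    -- as the new point does.
    (≤ᶜ-trans ℕ↣Γ (mk↣ inj₁-injective)) (λ _ _ → refl))

  i₂ : _↪_ χ M₀ M₂
  i₂ = embedding (mapᵉ-strong em (const nothing) (mk↣ id) (λ _ _ → refl) threads
    (λ {X} {Y} X≋Y x → trans (eval-i₂ X x) (trans (X≋Y x) (sym (eval-i₂ Y x))))
    -- The sort `K` is unchanged, so no set gains a point.
    (λ _ y _ → inj₁ (y , refl)))
    where
    eval-i₂ : ∀ X x → F₂.eval (mapᵉ (const nothing) id X) x ≡ F₀.eval X x
    eval-i₂ = eval-mapᵉ em {gens = gens₀} {gens₂} (const nothing) (mk↣ id) (λ _ _ → refl)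

  -- The contradiction in an amalgam

  no-amalgam : ¬ Amalgam χ M₀ M₁ M₂ i₁ i₂
  -- `c∈g` pulls back along `f₁` to an equation between `∞` and an old point, which lie in different
  -- summands of `K₁`.
  no-amalgam 𝒜 = case ⟦ lower (⇐ (f₁.ε-homo ∞ (single (inj₁ (inj₁ g)))) c∈g) ⟧⁻ of λ ()
    where
    open Amalgam 𝒜
    module N = 𝐊 N
    module ψ = _⊨ψ N.models
    module f₁ where
      open Embedding f₁ public
      open Isomorphism iso public
    module f₂ where
      open Embedding f₂ public
      open Isomorphism iso public

    ∞ : K₁
    ∞ = inj₂ tt

    c : N.K.Carrier
    c = f₁.embK ∞

    _∈₂_ : N.K.Carrier → Expr (Maybe C) K₀ → Set ℓ
    x ∈₂ X = x N.ε f₂.embP X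

    -- The coordinates of the function `g` are read off from the coordinate sets of `M₂` that
    -- contain `c` in the amalgam.
    point-of : χ.Carrier → Bool
    point-of α = ⟦ c ∈₂ gen (just (rep χ α)) ⟧

    g : Γ
    g = rep (2^ χ) (record
      { to   = point-of
      ; cong = λ α≈β → cong (λ γ → ⟦ c ∈₂ gen (just γ) ⟧) (Inverse.to-cong (norm em ac χ) α≈β)
      })

    g-point : ∀ α → proj₁ g ⟨$⟩ α ≡ point-of α
    g-point = Inverse.strictlyInverseʳ (norm em ac (2^ χ)) _

    c∈coordinate : ∀ α b → point-of α ≡ b → c ∈₂ coordinate α b
    c∈coordinate α true  eq = ⟦ ⇐ T-≡ eq ⟧⁻
    c∈coordinate α false eq = N.ε-resp N.K.refl (N.P.sym (f₂.ᶜ-homo _))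
      (⇐ (ψ.ε-ᶜ c _) λ c∈ → case trans (sym (⇒ T-≡ ⟦ c∈ ⟧⁺)) eq of λ ())

    -- `∞` belongs to `Γ` in `M₁`, and `agreeP` identifies the copies of `Γ` coming from both sides.
    c∈Γ : c ∈₂ gen nothing
    c∈Γ = N.ε-resp N.K.refl (agreeP (gen tt)) (⇒ (f₁.ε-homo ∞ (gen tt)) _)

    c∈π : ∀ α → c N.ε N.π α (f₂.embQ g)
    c∈π α = N.ε-resp N.K.refl (f₂.π-homo α g) (N.ε-resp N.K.refl (N.P.sym (f₂.∧-homo _ _))
      (⇐ (ψ.ε-∧ c _ _) (c∈Γ , c∈coordinate α (proj₁ g ⟨$⟩ α) (sym (g-point α)))))

    -- The singleton of `g` belongs to `M₀`, so its image by way of `M₁` is also its image by way of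
    -- `M₂`, where it is the intersection of the thread `g`.
    c∈g : c N.ε f₁.embP (single (inj₁ (inj₁ g)))
    c∈g = N.ε-resp N.K.refl (N.P.trans (N.P.sym (f₂.∩-homo g)) (N.P.sym (agreeP (single (inj₁ g)))))
      (⇐ (ψ.ε-∩ (f₂.embQ g) c) c∈π)

  ¬AP : ¬ AP χ κ
  ¬AP (_ , amalgamate) = no-amalgam (amalgamate M₀ M₁ M₂
    (universe≈κ gens₀ F₀.noSequences point K₀↣k k↣K₀ none)
    (universe≈κ gens₁ F₁.noSequences point K₁↣k k↣K₁ none)
    (universe≈κ gens₂ threads Maybe↣k K₀↣k k↣K₀ Γ↣k)
    i₁ i₂)

theorem4p4 : ∀ {ℓ : Level} → ExcludedMiddle ℓ → AxiomOfChoice ℓ →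
    (χ χ⁺ κ : Setoid ℓ ℓ) → Infinite χ → IsSuccessorOf χ⁺ χ → 2^ χ⁺ ≤ᶜ κ →
    ¬ AP χ κ
theorem4p4 em ac χ χ⁺ κ χ-infinite ((χ≤χ⁺ , _) , _) 2^χ⁺≤κ =
  Construction.¬AP em ac χ κ χ-infinite (≤ᶜ-trans (2^-mono em χ≤χ⁺) 2^χ⁺≤κ)
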